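{- Let $p\geq 5$ be an integer and let $(m_n)$ be the metallic numbers defined by $m_{ -1}=0$, $m_0=1$, $m_{n+2}=(p-2)m_{n+1}-m_n$. Then every positive integer $n$ can be written as $$n=\sum_{i=0}^{k} a_i\,m_i$$ for some $k\geq 0$ and digits $a_i\in\{1,2,\dots,p-2\}$ for all $i\in\{0,\dots,k\}$.
   Context: $p\ge 5$ is a fixed integer. The metallic numbers are $m_{ -1}=0$, $m_0=1$, $m_{n+2}=(p-2)m_{n+1}-m_n$ for $n\ge -1$ (so $m_1=p-2$). -}

module Defs where

open import Data.Nat.Base using (ℕ; zero; suc)
open import Data.Integer.Base using (ℤ; +_; _-_; _*_; 0ℤ; 1ℤ)
open import Data.Integer.Properties using (+-0-commutativeMonoid)

open import Algebra.Properties.CommutativeMonoid.Sum +-0-commutativeMonoid public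
  using (sum⁺-syntax)

-- The index is shifted by one, since the sequence starts at -1:
-- metallic₋₁ p j is m_{j-1}.  Values are integers so that the
-- subtraction in the recurrence is not truncated.
metallic₋₁ : ℕ → ℕ → ℤ
metallic₋₁ p zero          = 0ℤ
metallic₋₁ p (suc zero)    = 1ℤ
metallic₋₁ p (suc (suc j)) =
  (+ p - + 2) * metallic₋₁ p (suc j) - metallic₋₁ p j

metallic : ℕ → ℕ → ℤ
metallic p n = metallic₋₁ p (suc n)

{-# OPTIONS --safe #-}

-- Any sequence with q m_{j+1} = m_{j+2} + m_j satisfies
--   m_j + (q + 1) m_{j+1} = 2 m_j + m_{j+1} + m_{j+2}.
-- So one can count upwards: incrementing a digit q at position j + 1 resets it
-- to 1, carries one to position j + 2, and also carries one back to position j.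
-- If the increment came from a carry out of position j, the digit there was
-- just reset to 1, so it becomes 2 ≤ q and the backward carry does not propagate.
module Submission where

open import Defs
open import Data.Nat.Base using (ℕ; zero; suc; _≤_; _∸_; z≤n; s≤s)
open import Data.Nat.Properties using (_≟_; ≤∧≢⇒<; ≤-trans; n≤1+n)
open import Data.Integer.Base using (ℤ; +_; _*_; _+_; _-_)
open import Data.Integer.Properties using (+-identityˡ; +-0-commutativeMonoid)
open import Data.Integer.Tactic.RingSolver using (solve-∀)
open import Data.Fin.Base using (Fin; toℕ)
open import Data.List.Base using (List; []; _∷_; length; lookup)
open import Data.List.Membership.Propositional.Properties using (∈-lookup)
open import Data.List.Relation.Unary.All as All using (All; []; _∷_)
open import Data.Product.Base using (_×_; ∃-syntax; Σ-syntax; _,_)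
open import Function.Base using (_∘_; case_of_)
open import Relation.Nullary.Decidable using (yes; no)
open import Relation.Binary.PropositionalEquality
  using (_≡_; refl; cong; module ≡-Reasoning)
open import Algebra.Properties.CommutativeMonoid.Sum +-0-commutativeMonoid
  using (sum-syntax)

Digit : ℕ → ℕ → Set
Digit q d = 1 ≤ d × d ≤ q

value : (ℕ → ℤ) → List ℕ → ℤ
value m ds = ∑[ i < length ds ] (+ lookup ds i * m (toℕ i))

-- Stated for an arbitrary `m`, so that it passes to the shift `m ∘ suc` used in the recursion of
-- `carry`.
Recurrence : ℕ → (ℕ → ℤ) → Set
Recurrence q m = ∀ j → + q * m (suc j) ≡ m (suc (suc j)) + m j

-- The digits `ds` occupy positions 1, 2, ... and position 1 is incremented. The extra `m 0` stands
-- for a digit just reset to 1 at position 0; with it in the statement, `e` (1 or 2) absorbs the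
-- backward carry and the induction on `ds` closes.
carry : ∀ {q} → 2 ≤ q → (m : ℕ → ℤ) → Recurrence q m →
  ∀ ds → All (Digit q) ds →
  ∃[ e ] ∃[ es ] Digit q e × All (Digit q) es ×
    value m (e ∷ es) ≡ m 0 + (m 1 + value (m ∘ suc) ds)
carry 2≤q m rec [] [] =
  1 , 1 ∷ [] , one , one ∷ [] , identity (m 0) (m 1)
  where
  one = s≤s z≤n , ≤-trans (n≤1+n 1) 2≤q
  identity : ∀ x y → + 1 * x + (+ 1 * y + + 0) ≡ x + (y + + 0)
  identity = solve-∀
carry {q} 2≤q m rec (d ∷ ds) ((1≤d , d≤q) ∷ pds) with d ≟ q
... | no d≢q =
  1 , suc d ∷ ds , (s≤s z≤n , ≤-trans (n≤1+n 1) 2≤q) ,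
  (s≤s z≤n , ≤∧≢⇒< d≤q d≢q) ∷ pds ,
  identity (m 0) (m 1) (+ d) (value (m ∘ suc ∘ suc) ds)
  where
  identity : ∀ x y c v →
    + 1 * x + ((+ 1 + c) * y + v) ≡ x + (y + (c * y + v))
  identity = solve-∀
-- Of the `q + 1` copies of `m 1`, one is the reset digit and `q` become `m 2 + m 0`. The recursive
-- call takes `m 1 + m 2`; the `m 0` makes the digit 2.
... | yes refl with carry 2≤q (m ∘ suc) (rec ∘ suc) ds pds
...   | e , es , pe , pes , eq =
  2 , e ∷ es , (s≤s z≤n , 2≤q) , pe ∷ pes , (begin
    + 2 * m 0 + value (m ∘ suc) (e ∷ es)
      ≡⟨ cong (_+_ (+ 2 * m 0)) eq ⟩
    + 2 * m 0 + (m 1 + (m 2 + v))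
      ≡⟨ identity (m 0) (m 1) (m 2) v ⟩
    m 0 + (m 1 + ((m 2 + m 0) + v))
      ≡⟨ cong (λ t → m 0 + (m 1 + (t + v))) (rec 0) ⟨
    m 0 + (m 1 + (+ q * m 1 + v)) ∎)
  where
  open ≡-Reasoning
  v = value (m ∘ suc ∘ suc) ds
  identity : ∀ x y z v →
    + 2 * x + (y + (z + v)) ≡ x + (y + ((z + x) + v))
  identity = solve-∀

-- For `p = q + 2` the coefficient `+ p - + 2` computes to `+ q`.
metallic₋₁-recurrence : ∀ q → Recurrence q (metallic₋₁ (suc (suc q)))
metallic₋₁-recurrence q j =
  identity (+ q * metallic₋₁ (suc (suc q)) (suc j)) (metallic₋₁ (suc (suc q)) j)
  where
  identity : ∀ x y → x ≡ (x - y) + y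
  identity = solve-∀

representation : ∀ {q} → 2 ≤ q → ∀ n →
  ∃[ ds ] All (Digit q) ds × + n ≡ value (metallic (suc (suc q))) ds
representation 2≤q zero = [] , [] , refl
representation {q} 2≤q (suc n) with representation 2≤q n
... | ds , pds , n≡ds
  -- The backward carry out of position 0 is harmless because m₋₁ = 0.
  with carry 2≤q (metallic₋₁ (suc (suc q))) (metallic₋₁-recurrence q) ds pds
... | e , es , _ , pes , eq = es , pes , (begin
    + 1 + + n                                      ≡⟨ cong (_+_ (+ 1)) n≡ds ⟩
    + 1 + value m ds                               ≡⟨ +-identityˡ _ ⟨
    + 0 + (+ 1 + value m ds)                       ≡⟨ eq ⟨
    + e * + 0 + value m es                         ≡⟨ identity (+ e) (value m es) ⟩
    value m es                                     ∎)
  where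
  open ≡-Reasoning
  m = metallic (suc (suc q))
  identity : ∀ x y → x * + 0 + y ≡ y
  identity = solve-∀

theorem4 : (p : ℕ) → 5 ≤ p → (n : ℕ) → 1 ≤ n →
    ∃[ k ] Σ[ a ∈ (Fin (suc k) → ℕ) ]
    (∀ i → 1 ≤ a i × a i ≤ p ∸ 2) ×
    + n ≡ ∑[ i ≤ k ] (+ a i * metallic p (toℕ i))
theorem4 (suc (suc q)) (s≤s (s≤s 3≤q)) (suc n) _ =
  case representation (≤-trans (n≤1+n 2) 3≤q) (suc n) of λ where
    -- The empty list has value 0, so it cannot represent `suc n`; the top index `k` is one less
    -- than the number of digits.
    (d ∷ ds , pds , eq) →
      length ds , lookup (d ∷ ds) , (λ i → All.lookup pds (∈-lookup i)) , eq
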